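{- Any partial $(K_v,P_4)$-design can be embedded into a $(K_n,P_4)$-design for any admissible $n\geq v+2$.
   Context: $K_n$ is the complete graph on $n$ vertices and $P_4$ is the path with $4$ vertices and $3$ edges. A $(K_n,P_4)$-design is a set of subgraphs of $K_n$, each isomorphic to $P_4$, whose edge sets partition $E(K_n)$. An integer $n$ is admissible if a $(K_n,P_4)$-design exists. A partial $(K_v,P_4)$-design is a set of pairwise edge-disjoint subgraphs of $K_v$, each isomorphic to $P_4$. A partial $(K_v,P_4)$-design $\mathcal B$ is embedded into a $(K_n,P_4)$-design $\mathcal B'$ if $V(K_v)\subseteq V(K_n)$ and $\mathcal B\subseteq\mathcal B'$. -}

module Defs where

open import Level using (0ℓ)
open import Data.Nat using (ℕ; suc; _≤_)
open import Data.Nat.Properties using (1+n≢n)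
open import Data.Fin using (Fin; toℕ; inject≤)
open import Data.Fin.Properties using (inject≤-injective)
open import Data.List using (List)
open import Data.List.Relation.Unary.All using (All)
open import Data.List.Relation.Unary.Any using (Any)
open import Data.List.Relation.Unary.AllPairs using (AllPairs)
open import Data.Product using (Σ; ∃; ∃₂; _×_; _,_)
open import Data.Sum using (_⊎_; inj₁; inj₂; swap)
open import Function.Definitions using (Injective)
open import Relation.Nullary using (¬_)
open import Relation.Unary using (Pred; _≐_)
open import Relation.Binary using (Rel; Symmetric; Irreflexive; _⇒_; _⇔_)
open import Relation.Binary.PropositionalEquality
  using (_≡_; _≢_; refl; sym; trans; cong; ≢-sym)

-- Undirected edges are encoded as symmetric relations: the edge {x , y}
-- is present iff x and y are related (in either order).

record Graph (V : Set) : Set₁ where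
  field
    Adj        : Rel V 0ℓ
    adj-sym    : Symmetric Adj
    adj-irrefl : Irreflexive _≡_ Adj

K : (n : ℕ) → Graph (Fin n)
K n = record
  { Adj        = _≢_
  ; adj-sym    = ≢-sym
  ; adj-irrefl = λ x≡y x≢y → x≢y x≡y
  }

-- P n has n vertices, hence n ∸ 1 edges.
P : (n : ℕ) → Graph (Fin n)
P n = record
  { Adj        = λ i j → suc (toℕ i) ≡ toℕ j ⊎ suc (toℕ j) ≡ toℕ i
  ; adj-sym    = swap
  ; adj-irrefl = λ { refl (inj₁ e) → 1+n≢n e ; refl (inj₂ e) → 1+n≢n e }
  }

record Subgraph {V : Set} (G : Graph V) : Set₁ where
  field
    Vert     : Pred V 0ℓ
    Edge     : Rel V 0ℓ
    edge-sym : Symmetric Edge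
    edge⊆    : Edge ⇒ Graph.Adj G
    edge-end : ∀ {x y} → Edge x y → Vert x

open Subgraph public

-- Equality of subgraphs: same vertex set and same edge set.
infix 4 _≈_
_≈_ : {V : Set} {G : Graph V} → Rel (Subgraph G) 0ℓ
H ≈ H′ = (Vert H ≐ Vert H′) × (Edge H ⇔ Edge H′)

-- A graph isomorphism from F onto H, given by an injection into the
-- ambient vertex type whose image is exactly the vertex set of H.
infix 4 _≅_
record _≅_ {V W : Set} {G : Graph V} (H : Subgraph G) (F : Graph W) : Set where
  field
    to         : W → V
    injective  : Injective _≡_ _≡_ to
    to-vert    : ∀ i → Vert H (to i)
    surjective : ∀ {x} → Vert H x → ∃ λ i → to i ≡ x
    to-edge    : ∀ {i j} → Graph.Adj F i j → Edge H (to i) (to j)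
    from-edge  : ∀ {i j} → Edge H (to i) (to j) → Graph.Adj F i j

EdgeDisjoint : {V : Set} {G : Graph V} → Rel (Subgraph G) 0ℓ
EdgeDisjoint H H′ = ∀ {x y} → Edge H x y → ¬ Edge H′ x y

-- Sets of subgraphs are lists of subgraphs; edge-disjointness of entries at
-- different positions already excludes repetitions, as P 4 has an edge.

record IsPartialDesign {n : ℕ} (B : List (Subgraph (K n))) : Set₁ where
  field
    blocks   : All (_≅ P 4) B
    disjoint : AllPairs EdgeDisjoint B

record IsDesign {n : ℕ} (B : List (Subgraph (K n))) : Set₁ where
  field
    isPartialDesign : IsPartialDesign B
    covers          : ∀ {x y} → Graph.Adj (K n) x y → Any (λ H → Edge H x y) B

Admissible : ℕ → Set₁
Admissible n = ∃ λ (B : List (Subgraph (K n))) → IsDesign B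

-- A subgraph of K v viewed as a subgraph of K n, identifying the vertices
-- of K v with the first v vertices of K n.
extend : ∀ {v n} → v ≤ n → Subgraph (K v) → Subgraph (K n)
extend v≤n H = record
  { Vert     = λ x → ∃ λ a → ι a ≡ x × Vert H a
  ; Edge     = λ x y → ∃₂ λ a b → ι a ≡ x × ι b ≡ y × Edge H a b
  ; edge-sym = λ (a , b , p , q , e) → b , a , q , p , edge-sym H e
  ; edge⊆    = λ (a , b , p , q , e) x≡y →
      edge⊆ H e (inject≤-injective v≤n v≤n a b (trans p (trans x≡y (sym q))))
  ; edge-end = λ (a , b , p , q , e) → a , p , edge-end H e
  }
  where ι = λ a → inject≤ a v≤n

EmbeddedIn : ∀ {v n} → List (Subgraph (K v)) → List (Subgraph (K n)) → Set₁
EmbeddedIn {v} {n} B B′ =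
  Σ (v ≤ n) λ v≤n → All (λ H → Any (extend v≤n H ≈_) B′) B

-- Choose two vertices a, b of K_n outside K_v, and let L be the graph, on the remaining n − 2
-- vertices S, of the edges not covered by B. What has to be decomposed is the join of L with the
-- edge ab. Paths inside L are removed as long as there are any; then every component of L is a
-- triangle or a star. A triangle together with its edges to a and b decomposes, and so do two edges
-- xy, xz of a star together with the edges from the leaves y, z to a and b. This reduces the stars
-- to isolated edges and isolated vertices; two isolated edges are reduced to two isolated vertices,
-- and the edges from three isolated vertices to a and b decompose. What is left at the end is
-- small, and since the number of edges is divisible by 3, it is decomposable or the triangle on
-- a, b and one more vertex; the latter is avoided by treating it together with the step before it.
-- The divisibility comes from comparing with the design that exists because n is admissible.
module Submission where

open import Defs
open import Data.Nat using (ℕ; zero; suc; _+_; _≥_; _≤_; _<_; s≤s; z≤n; _≤?_; _<?_)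
open import Data.Nat.Properties
  using (≤-refl; ≤-trans; m≤n+m; ≤-antisym; +-comm; n≤1+n; <-trans; <-irrefl; <-cmp; 1+n≢n)
open import Data.Nat.Divisibility using (_∣_; _∣?_; _∣0; ∣m+n∣m⇒∣n; ∣m∣n⇒∣m+n; ∣-refl)
open import Data.Fin as Fin using (Fin; zero; suc; toℕ; fromℕ<; inject≤)
import Data.Fin.Properties as Fin
open import Data.Fin.Patterns
open import Data.List
  using (List; []; _∷_; _++_; length; lookup; removeAt; map; allFin; filter; cartesianProduct)
open import Data.List.Properties using (++-assoc; length-++; length-tabulate)
open import Data.List.Relation.Unary.All as All using (All; []; _∷_)
import Data.List.Relation.Unary.All.Properties as All
open import Data.List.Relation.Unary.Any as Any using (Any; here; there)
import Data.List.Relation.Unary.Any.Properties as Any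
open import Data.List.Relation.Unary.AllPairs as AllPairs using (AllPairs; []; _∷_; allPairs?)
import Data.List.Relation.Unary.AllPairs.Properties as AllPairs
open import Data.List.Relation.Unary.Unique.Propositional using (Unique)
import Data.List.Relation.Unary.Unique.Propositional.Properties as Unique
open import Data.List.Membership.Propositional using (_∈_)
open import Data.List.Membership.Propositional.Properties
  using (∈-∃++; ∈-lookup; ∈-allFin; ∈-filter⁺; ∈-filter⁻; ∈-cartesianProduct⁺; ∈-cartesianProduct⁻)
open import Data.List.Relation.Binary.Sublist.Propositional
  using (_⊆_; []; _∷_; _∷ʳ_; ⊆-refl; minimum; from∈)
open import Data.List.Relation.Binary.Sublist.Propositional.Properties using (All-resp-⊆) renaming (++⁺ to ⊆-++⁺)
import Data.List.Relation.Binary.Permutation.Propositional as Perm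
import Data.List.Relation.Binary.Permutation.Propositional.Properties as Perm
import Data.List.Relation.Binary.Permutation.Setoid as Permutation
import Data.List.Relation.Binary.Permutation.Setoid.Properties as PermutationProperties
open import Data.Maybe using (Maybe; just; nothing)
open import Data.Product using (Σ; ∃; ∃₂; _×_; _,_; proj₁; proj₂)
open import Data.Sum using (_⊎_; inj₁; inj₂)
open import Data.Empty using (⊥)
open import Function using (_∘_; id)
open import Function.Definitions using (Injective)
open import Level using (0ℓ)
open import Relation.Binary using (Setoid; DecidableEquality; Decidable; tri<; tri≈; tri>)
open import Relation.Binary.PropositionalEquality
  using (_≡_; _≢_; refl; sym; trans; cong; subst; subst₂; ≢-sym; setoid)
open import Relation.Nullary using (¬_; Dec; yes; no; contradiction; ¬?)
open import Relation.Nullary.Decidable using (True; toWitness; from-no; map′; _⊎-dec_; _×-dec_)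

-- Undirected edges, and lists without repetitions

UEdge : Set → Set
UEdge V = V × V

infix 4 _∼_
data _∼_ {V : Set} : UEdge V → UEdge V → Set where
  same : ∀ {e} → e ∼ e
  flip : ∀ {x y} → (x , y) ∼ (y , x)

∼-sym : ∀ {V} {e f : UEdge V} → e ∼ f → f ∼ e
∼-sym same = same
∼-sym flip = flip

∼-trans : ∀ {V} {e f g : UEdge V} → e ∼ f → f ∼ g → e ∼ g
∼-trans same q    = q
∼-trans p    same = p
∼-trans flip flip = same

edgeSetoid : Set → Setoid 0ℓ 0ℓ
edgeSetoid V = record
  { Carrier       = UEdge V
  ; _≈_           = _∼_
  ; isEquivalence = record { refl = same ; sym = ∼-sym ; trans = ∼-trans }
  }

infix 4 _∈∼_
_∈∼_ : ∀ {V} → UEdge V → List (UEdge V) → Set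
e ∈∼ T = Any (e ∼_) T

∼⁻ : ∀ {V} {x y u w : V} → (x , y) ∼ (u , w) → x ≡ u × y ≡ w ⊎ x ≡ w × y ≡ u
∼⁻ same = inj₁ (refl , refl)
∼⁻ flip = inj₂ (refl , refl)

∼? : ∀ {V} → DecidableEquality V → Decidable (_∼_ {V})
∼? _≟_ (x , y) (u , w) =
  map′ (λ { (inj₁ (refl , refl)) → same ; (inj₂ (refl , refl)) → flip }) ∼⁻
    ((x ≟ u ×-dec y ≟ w) ⊎-dec (x ≟ w ×-dec y ≟ u))

lookup-injective : ∀ {A : Set} {xs : List A} → Unique xs → Injective _≡_ _≡_ (lookup xs)
lookup-injective (_ ∷ _)  {zero}  {zero}  _  = refl
lookup-injective (x∉ ∷ _) {zero}  {suc j} eq = contradiction eq (All.lookup x∉ (∈-lookup j))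
lookup-injective (x∉ ∷ _) {suc i} {zero}  eq = contradiction (sym eq) (All.lookup x∉ (∈-lookup i))
lookup-injective (_ ∷ u)  {suc i} {suc j} eq = cong suc (lookup-injective u eq)

Unique-resp-⊆ : ∀ {A : Set} {xs ys : List A} → xs ⊆ ys → Unique ys → Unique xs
Unique-resp-⊆ []         _        = []
Unique-resp-⊆ (_ ∷ʳ τ)   (_ ∷ u)  = Unique-resp-⊆ τ u
Unique-resp-⊆ (refl ∷ τ) (y∉ ∷ u) = All-resp-⊆ τ y∉ ∷ Unique-resp-⊆ τ u

extract : ∀ {A : Set} {x : A} {xs} → x ∈ xs → ∃ λ ys → xs Perm.↭ x ∷ ys
extract {x = x} x∈xs with ys , zs , refl ← ∈-∃++ x∈xs = ys ++ zs , Perm.shift x ys zs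

extract₂ : ∀ {A : Set} {x y : A} {xs} → x ∈ xs → y ∈ xs → x ≢ y →
           ∃ λ ys → xs Perm.↭ x ∷ y ∷ ys
extract₂ x∈ y∈ x≢y =
  let ys , σ = extract x∈
      zs , τ = extract (Any.tail (≢-sym x≢y) (Perm.∈-resp-↭ σ y∈))
  in zs , Perm.↭-trans σ (Perm.↭-prep _ τ)

extract₃ : ∀ {A : Set} {x y z : A} {xs} → x ∈ xs → y ∈ xs → z ∈ xs → x ≢ y → x ≢ z → y ≢ z →
           ∃ λ ys → xs Perm.↭ x ∷ y ∷ z ∷ ys
extract₃ x∈ y∈ z∈ x≢y x≢z y≢z =
  let ys , σ = extract₂ x∈ y∈ x≢y
      zs , τ = extract (Any.tail (≢-sym y≢z) (Any.tail (≢-sym x≢z) (Perm.∈-resp-↭ σ z∈)))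
  in zs , Perm.↭-trans σ (Perm.↭-prep _ (Perm.↭-prep _ τ))

Unique-resp-↭ : ∀ {A : Set} {xs ys : List A} → xs Perm.↭ ys → Unique xs → Unique ys
Unique-resp-↭ {A} p = PermutationProperties.Unique-resp-↭ (setoid A) (Perm.↭⇒↭ₛ p)

Loopless : ∀ {V : Set} → List (UEdge V) → Set
Loopless = All (λ (p , q) → p ≢ q)

-- Removing paths from edge lists

module PathRemoval (V : Set) where

  open Permutation (edgeSetoid V) public
    using (_↭_; prep; ↭-refl; ↭-sym; ↭-trans; ↭-prep; ↭-swap)
  open PermutationProperties (edgeSetoid V) public
    using (All-resp-↭; Any-resp-↭; shifts; ↭-shift; ++⁺; ++⁺ˡ; ++⁺ʳ; ++-comm; xs↭ys⇒|xs|≡|ys|)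
    renaming (Unique-resp-↭ to Simple-resp-↭)

  Simple : List (UEdge V) → Set
  Simple = AllPairs (λ e f → ¬ e ∼ f)

  -- `T ⟶ []` is a decomposition of `T` into copies of P_4. As `↭` is permutation up to `∼`, a
  -- `perm` step may reverse edges as well as reorder them.
  infix 3 _⟶_
  data _⟶_ : List (UEdge V) → List (UEdge V) → Set where
    done : ∀ {T} → T ⟶ T
    path : ∀ {p q r s T T′} → Unique (p ∷ q ∷ r ∷ s ∷ []) → T ⟶ T′ →
           (p , q) ∷ (q , r) ∷ (r , s) ∷ T ⟶ T′
    perm : ∀ {T T₁ T′} → T ↭ T₁ → T₁ ⟶ T′ → T ⟶ T′

  ⟶-trans : ∀ {T T₁ T₂} → T ⟶ T₁ → T₁ ⟶ T₂ → T ⟶ T₂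
  ⟶-trans done       q = q
  ⟶-trans (path u p) q = path u (⟶-trans p q)
  ⟶-trans (perm σ p) q = perm σ (⟶-trans p q)

  ⟶-++ʳ : ∀ X {T T′} → T ⟶ T′ → T ++ X ⟶ T′ ++ X
  ⟶-++ʳ X done       = done
  ⟶-++ʳ X (path u p) = path u (⟶-++ʳ X p)
  ⟶-++ʳ X (perm σ p) = perm (++⁺ʳ X σ) (⟶-++ʳ X p)

  ⟶-++ˡ : ∀ X {T T′} → T ⟶ T′ → X ++ T ⟶ X ++ T′
  ⟶-++ˡ X {T} {T′} p = perm (++-comm X T) (⟶-trans (⟶-++ʳ X p) (perm (++-comm T′ X) done))

  ⟶-∣length : ∀ {T T′} → T ⟶ T′ → 3 ∣ length T → 3 ∣ length T′
  ⟶-∣length done       d = d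
  ⟶-∣length (path _ p) d = ⟶-∣length p (∣m+n∣m⇒∣n d ∣-refl)
  ⟶-∣length (perm σ p) d = ⟶-∣length p (subst (3 ∣_) (xs↭ys⇒|xs|≡|ys| σ) d)

  Decomposable : List (UEdge V) → Set
  Decomposable T = 3 ∣ length T → T ⟶ []

  -- Every path takes away three edges, so divisibility by 3 passes to the remainder. It has to be
  -- established only once, for the whole list, and is then at hand in all the small cases.
  via : ∀ {T T′} → T ⟶ T′ → Decomposable T′ → Decomposable T
  via p dec d = ⟶-trans p (dec (⟶-∣length p d))

  pull : ∀ T i {e} → lookup T i ∼ e → T ↭ e ∷ removeAt T i
  pull (_ ∷ _)     zero    e = prep e ↭-refl
  pull (f ∷ g ∷ T) (suc i) e = ↭-trans (↭-prep f (pull (g ∷ T) i e)) (↭-swap f _ ↭-refl)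

  pull₃ : ∀ T {e e′ e″} i → lookup T i ∼ e →
          (let T₁ = removeAt T i) → ∀ j → lookup T₁ j ∼ e′ →
          (let T₂ = removeAt T₁ j) → ∀ k → lookup T₂ k ∼ e″ →
          T ↭ e ∷ e′ ∷ e″ ∷ removeAt T₂ k
  pull₃ T i e j e′ k e″ =
    ↭-trans (pull T i e) (↭-prep _ (↭-trans (pull _ j e′) (↭-prep _ (pull _ k e″))))

  -- Distinctness of the four vertices is inherited from their indices in `vs`, where it is decided
  -- by evaluation; an explicit decomposition thus consists of indices and positions only.
  pathAt : ∀ {vs : List V} → Unique vs → (p q r s : Fin (length vs)) →
           {True (allPairs? (λ i j → ¬? (i Fin.≟ j)) (p ∷ q ∷ r ∷ s ∷ []))} →
           ∀ {T T′} i → lookup T i ∼ (lookup vs p , lookup vs q) →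
           (let T₁ = removeAt T i) → ∀ j → lookup T₁ j ∼ (lookup vs q , lookup vs r) →
           (let T₂ = removeAt T₁ j) → ∀ k → lookup T₂ k ∼ (lookup vs r , lookup vs s) →
           removeAt T₂ k ⟶ T′ → T ⟶ T′
  pathAt u p q r s {distinct} {T} i e j e′ k e″ red =
    perm (pull₃ T i e j e′ k e″)
      (path (Unique.map⁺ (lookup-injective u) (toWitness distinct)) red)

  -- For a configuration whose edges sit in two places of `total`: `A` among the edges of the graph,
  -- `C` among the edges to `a` and `b`.
  absorb : ∀ A B C {D} → A ++ C ⟶ [] → A ++ B ++ C ++ D ⟶ B ++ D
  absorb A B C {D} p =
    perm (↭-trans (shifts A B) (++⁺ˡ B (Permutation.↭-reflexive (edgeSetoid V) (sym (++-assoc A C D)))))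
      (⟶-++ˡ B (⟶-++ʳ D p))

-- The join of a graph with an edge

module Joins {V : Set} (_≟_ : DecidableEquality V) (a b : V) where

  open PathRemoval V public

  apex : List V → List (UEdge V)
  apex []      = []
  apex (x ∷ S) = (x , a) ∷ (x , b) ∷ apex S

  -- At most one isolated edge of L is put aside, until a second one is found to pair it with.
  ends : Maybe (V × V) → List V
  ends nothing        = []
  ends (just (z , w)) = z ∷ w ∷ []

  kept : Maybe (V × V) → List (UEdge V)
  kept nothing        = []
  kept (just (z , w)) = (z , w) ∷ apex (z ∷ w ∷ [])

  -- The join of the graph (S , E), together with the edge put aside, with the edge ab.
  total : List (UEdge V) → Maybe (V × V) → List V → List (UEdge V)
  total E M S = E ++ apex S ++ kept M ++ (a , b) ∷ []

  Within : List V → UEdge V → Set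
  Within S (p , q) = p ∈ S × q ∈ S × p ≢ q

  Avoids : V → UEdge V → Set
  Avoids x (p , q) = p ≢ x × q ≢ x

  -- Since `E` stays within `S`, the edge put aside is isolated. `big` excludes the triangle on `a`,
  -- `b` and one more vertex: its three edges pass the divisibility test but form no path.
  record Inv (E : List (UEdge V)) (M : Maybe (V × V)) (S : List V) : Set where
    constructor inv
    field
      verts  : Unique (a ∷ b ∷ ends M ++ S)
      simple : Simple E
      within : All (Within S) E
      big    : 2 ≤ length (ends M ++ S)

  Within-resp : ∀ {S} {e f : UEdge V} → e ∼ f → Within S e → Within S f
  Within-resp same w               = w
  Within-resp flip (p∈ , q∈ , p≢q) = q∈ , p∈ , ≢-sym p≢q

  Avoids-resp : ∀ {x} {e f : UEdge V} → e ∼ f → Avoids x e → Avoids x f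
  Avoids-resp same w           = w
  Avoids-resp flip (p≢ , q≢) = q≢ , p≢

  narrow : ∀ {x S E} → All (Within (x ∷ S)) E → All (Avoids x) E → All (Within S) E
  narrow []                     []                  = []
  narrow ((p∈ , q∈ , p≢q) ∷ ws) ((p≢x , q≢x) ∷ avs) =
    (Any.tail p≢x p∈ , Any.tail q≢x q∈ , p≢q) ∷ narrow ws avs

  Inv-edges : ∀ {E E′ M S} → E ↭ E′ → Inv E M S → Inv E′ M S
  Inv-edges σ (inv v s w l) = inv v (Simple-resp-↭ σ s) (All-resp-↭ Within-resp σ w) l

  Inv-vertices : ∀ {E M S S′} → S Perm.↭ S′ → Inv E M S → Inv E M S′
  Inv-vertices {M = M} σ (inv v s w l) = inv
    (Unique-resp-↭ (Perm.↭-prep a (Perm.↭-prep b τ)) v) s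
    (All.map (λ (p∈ , q∈ , p≢q) → Perm.∈-resp-↭ σ p∈ , Perm.∈-resp-↭ σ q∈ , p≢q) w)
    (subst (2 ≤_) (Perm.↭-length τ) l)
    where τ = Perm.++⁺ˡ (ends M) σ

  Inv-tail : ∀ {e E M S} → Inv (e ∷ E) M S → Inv E M S
  Inv-tail (inv v (_ ∷ s) (_ ∷ w) l) = inv v s w l

  apex-resp-↭ : ∀ {S S′} → S Perm.↭ S′ → apex S ↭ apex S′
  apex-resp-↭ Perm.refl         = ↭-refl
  apex-resp-↭ (Perm.prep x σ)   = ↭-prep _ (↭-prep _ (apex-resp-↭ σ))
  apex-resp-↭ (Perm.swap x y σ) =
    ↭-trans (shifts (apex (x ∷ [])) (apex (y ∷ []))) (++⁺ˡ (apex (y ∷ x ∷ [])) (apex-resp-↭ σ))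
  apex-resp-↭ (Perm.trans σ τ)  = ↭-trans (apex-resp-↭ σ) (apex-resp-↭ τ)

  total-edges : ∀ {E E′ M S} → E ↭ E′ → total E M S ⟶ total E′ M S
  total-edges σ = perm (++⁺ʳ _ σ) done

  total-vertices : ∀ {E M S S′} → S Perm.↭ S′ → total E M S ⟶ total E M S′
  total-vertices {E} σ = perm (++⁺ˡ E (++⁺ʳ _ (apex-resp-↭ σ))) done

  -- The edge found is turned so that `x` comes first; the case analyses below rely on this normal
  -- form.
  split : ∀ x E → (∃₂ λ z E′ → E ↭ (x , z) ∷ E′) ⊎ All (Avoids x) E
  split x []            = inj₂ []
  split x ((p , q) ∷ E) with p ≟ x | q ≟ x
  ... | yes refl | _        = inj₁ (q , E , ↭-refl)
  ... | no _     | yes refl = inj₁ (p , E , prep flip ↭-refl)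
  ... | no p≢x   | no q≢x   with split x E
  ...   | inj₁ (z , E′ , σ) = inj₁ (z , _ , ↭-trans (↭-prep _ σ) (↭-swap _ _ ↭-refl))
  ...   | inj₂ avoids       = inj₂ ((p≢x , q≢x) ∷ avoids)

  -- In the decompositions below, pathAt u p q r s i _ j _ k _ removes the path through the vertices
  -- number p, q, r, s of the list in the type of u. Its edges are at positions i, j, k of the edge
  -- list, each counted after the removal of the previous ones.
  three-isolated : ∀ {x y z} → Unique (a ∷ b ∷ x ∷ y ∷ z ∷ []) → apex (x ∷ y ∷ z ∷ []) ⟶ []
  three-isolated u =
    pathAt u 2F 0F 3F 1F 0F same 1F flip 1F same (
    pathAt u 2F 1F 4F 0F 0F same 1F flip 0F same done)

  -- Treated as a whole, because `three-isolated` would leave the triangle `abw`. The edge `ab`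
  -- becomes the middle of the path `x a b y`.
  four-isolated : ∀ {x y z w} → Unique (a ∷ b ∷ x ∷ y ∷ z ∷ w ∷ []) →
                  total [] nothing (x ∷ y ∷ z ∷ w ∷ []) ⟶ []
  four-isolated u =
    pathAt u 2F 0F 1F 3F 0F same 7F same 2F flip (
    pathAt u 3F 0F 4F 1F 1F same 1F flip 1F same (
    pathAt u 2F 1F 5F 0F 0F same 1F flip 0F same done))

  -- This is the complete graph on `a`, `b`, `z`, `w`.
  one-edge : ∀ {z w} → Unique (a ∷ b ∷ z ∷ w ∷ []) → total [] (just (z , w)) [] ⟶ []
  one-edge u =
    pathAt u 2F 3F 0F 1F 0F same 2F same 3F same (
    pathAt u 0F 2F 1F 3F 0F flip 0F same 0F flip done)

  -- The edges `xa` and `xb` are left alone: the centre `x` stays in the graph, possibly with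
  -- further leaves, and only `y` and `z` disappear.
  cherry : ∀ {x y z} → Unique (a ∷ b ∷ y ∷ z ∷ x ∷ []) →
           (x , y) ∷ (x , z) ∷ apex (y ∷ z ∷ []) ⟶ []
  cherry u =
    pathAt u 4F 2F 0F 3F 0F same 1F same 2F flip (
    pathAt u 4F 3F 1F 2F 0F same 1F same 0F flip done)

  whole-cherry : ∀ {x y z} → Unique (a ∷ b ∷ y ∷ z ∷ x ∷ []) →
                 total ((x , y) ∷ (x , z) ∷ []) nothing (y ∷ z ∷ x ∷ []) ⟶ []
  whole-cherry u =
    pathAt u 2F 4F 0F 3F 0F flip 5F same 3F flip (
    pathAt u 2F 0F 1F 3F 1F same 4F same 2F flip (
    pathAt u 2F 1F 4F 3F 1F same 1F flip 0F same done))

  -- Each side is the middle of a path from `a` to `b`. Going round the triangle cyclically, every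
  -- corner is joined once to `a` and once to `b`.
  triangle : ∀ {x y z} → Unique (a ∷ b ∷ x ∷ y ∷ z ∷ []) →
             (x , y) ∷ (x , z) ∷ (y , z) ∷ apex (x ∷ y ∷ z ∷ []) ⟶ []
  triangle u =
    pathAt u 0F 2F 3F 1F 3F flip 0F same 4F same (
    pathAt u 0F 3F 4F 1F 3F flip 1F same 3F same (
    pathAt u 0F 4F 2F 1F 2F flip 0F flip 0F same done))

  -- Needed because `triangle` alone would leave the triangle `abw`.
  triangle-and-isolated : ∀ {x y z w} → Unique (a ∷ b ∷ x ∷ y ∷ z ∷ w ∷ []) →
    total ((x , y) ∷ (x , z) ∷ (y , z) ∷ []) nothing (x ∷ y ∷ z ∷ w ∷ []) ⟶ []
  triangle-and-isolated u =
    pathAt u 5F 0F 2F 3F 9F same 3F flip 0F same (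
    pathAt u 5F 1F 3F 4F 7F same 4F flip 1F same (
    pathAt u 4F 2F 1F 0F 0F flip 0F same 3F flip (
    pathAt u 3F 0F 4F 1F 0F same 0F flip 0F same done)))

  -- The paths `x y a w` and `z w b y` use up `w` and `y`; the other ends `z` and `x` survive as
  -- isolated vertices.
  two-edges : ∀ {x y z w} → Unique (a ∷ b ∷ z ∷ w ∷ x ∷ y ∷ []) →
              kept (just (z , w)) ++ kept (just (x , y)) ⟶ apex (z ∷ x ∷ [])
  two-edges u =
    pathAt u 4F 5F 0F 3F 5F same 7F same 3F flip (
    pathAt u 2F 3F 1F 5F 0F same 2F same 4F flip done)

  -- Vertices go three at a time. For k vertices in `S` there are 2k + 1 edges if nothing is put
  -- aside, so k is 1 modulo 3, and `big` makes 4 the smallest case. With an edge put aside there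
  -- are 2k + 6 edges, so k is 0 modulo 3 and the smallest case is `one-edge`.
  isolated-vertices : ∀ M S → Unique (a ∷ b ∷ ends M ++ S) → 2 ≤ length (ends M ++ S) →
                      Decomposable (total [] M S)
  isolated-vertices nothing []                   u ()       d
  isolated-vertices nothing (_ ∷ [])             u (s≤s ()) d
  isolated-vertices nothing (_ ∷ _ ∷ [])         u l d = contradiction d (from-no (3 ∣? 5))
  isolated-vertices nothing (_ ∷ _ ∷ _ ∷ [])     u l d = contradiction d (from-no (3 ∣? 7))
  isolated-vertices nothing (_ ∷ _ ∷ _ ∷ _ ∷ []) u l d = four-isolated u
  isolated-vertices nothing (_ ∷ _ ∷ _ ∷ S@(_ ∷ _ ∷ _)) u l =
    via (⟶-++ʳ _ (three-isolated (Unique.take⁺ 5 u)))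
      (isolated-vertices nothing S
        (Unique-resp-⊆ (refl ∷ refl ∷ _ ∷ʳ _ ∷ʳ _ ∷ʳ ⊆-refl) u) (s≤s (s≤s z≤n)))
  isolated-vertices (just _) []           u l d = one-edge u
  isolated-vertices (just _) (_ ∷ [])     u l d = contradiction d (from-no (3 ∣? 8))
  isolated-vertices (just _) (_ ∷ _ ∷ []) u l d = contradiction d (from-no (3 ∣? 10))
  isolated-vertices (just _) (x ∷ y ∷ z ∷ S) u l =
    via (⟶-++ʳ _ (three-isolated (Unique.take⁺ 5
          (Unique-resp-⊆ (refl ∷ refl ∷ _ ∷ʳ _ ∷ʳ ⊆-refl) u))))
      (isolated-vertices (just _) S
        (Unique-resp-⊆ (refl ∷ refl ∷ refl ∷ refl ∷ _ ∷ʳ _ ∷ʳ _ ∷ʳ ⊆-refl) u) (s≤s (s≤s z≤n)))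

  -- Reducing the number of edges of the graph

  module Step (k : ℕ)
    (IH : ∀ {E M S} → length E ≤ k → Inv E M S → Decomposable (total E M S)) where

    remove-path : ∀ {E E′ M S p q r s} → E ↭ (p , q) ∷ (q , r) ∷ (r , s) ∷ E′ →
                  Unique (p ∷ q ∷ r ∷ s ∷ []) → length E ≤ suc k → Inv E M S →
                  Decomposable (total E M S)
    remove-path σ u l I with s≤s l′ ← subst (_≤ suc k) (xs↭ys⇒|xs|≡|ys| σ) l =
      via (perm (++⁺ʳ _ σ) (path u done))
        (IH (≤-trans (m≤n+m _ 2) l′) (Inv-tail (Inv-tail (Inv-tail (Inv-edges σ I)))))

    remove-cherry : ∀ {x y z E M S} → Inv ((x , y) ∷ (x , z) ∷ E) M S →
                    All (Avoids y) E → All (Avoids z) E → length E ≤ k →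
                    Decomposable (total ((x , y) ∷ (x , z) ∷ E) M S)
    remove-cherry {x} {y} {z} {E} {M} I@(inv _ ((y≁z ∷ _) ∷ _) ((x∈ , y∈ , x≢y) ∷ (_ , z∈ , x≢z) ∷ _) _)
      avoid-y avoid-z l
      with S , σ ← extract₂ y∈ z∈ (λ { refl → y≁z same }) = via (total-vertices {M = M} σ)
        (finish S (Any.tail x≢z (Any.tail x≢y (Perm.∈-resp-↭ σ x∈))) (Inv-vertices σ I)
          (2 ≤? length (ends M ++ S)))
      where
      -- Removing the cherry would leave the triangle abx if x were the last vertex.
      finish : ∀ S → x ∈ S → Inv ((x , y) ∷ (x , z) ∷ E) M (y ∷ z ∷ S) →
               Dec (2 ≤ length (ends M ++ S)) →
               Decomposable (total ((x , y) ∷ (x , z) ∷ E) M (y ∷ z ∷ S))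
      finish S x∈S (inv v (_ ∷ _ ∷ s) (_ ∷ _ ∷ w) _) (yes big) =
        via (absorb ((x , y) ∷ (x , z) ∷ []) E (apex (y ∷ z ∷ []))
              (cherry (Unique-resp-⊆ (refl ∷ refl ∷ ⊆-++⁺ (minimum (ends M)) (refl ∷ refl ∷ from∈ x∈S)) v)))
          (IH l (inv
            (Unique-resp-⊆ (refl ∷ refl ∷ ⊆-++⁺ (⊆-refl {x = ends M}) (_ ∷ʳ _ ∷ʳ ⊆-refl)) v)
            s (narrow (narrow w avoid-y) avoid-z) big))
      finish S x∈S (inv v _ (_ ∷ _ ∷ w) _) (no small) =
        -- Fewer than two vertices remain and `x` is among them. Hence nothing is put aside, `S`
        -- consists of `x` alone, and `E`, having no loops, is empty.
        terminal M S x∈S E v (narrow (narrow w avoid-y) avoid-z) small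
        where
        terminal : ∀ M S → x ∈ S → ∀ E → Unique (a ∷ b ∷ ends M ++ y ∷ z ∷ S) → All (Within S) E →
                   ¬ 2 ≤ length (ends M ++ S) → Decomposable (total ((x , y) ∷ (x , z) ∷ E) M (y ∷ z ∷ S))
        terminal (just _) S       x∈S         E  v w small d = contradiction (s≤s (s≤s z≤n)) small
        terminal nothing (_ ∷ []) (here refl) [] v w small d = whole-cherry v
        terminal nothing (_ ∷ []) _ _ v ((here refl , here refl , p≢q) ∷ _) small d = contradiction refl p≢q
        terminal nothing (_ ∷ _ ∷ _) _ _ v w small d = contradiction (s≤s (s≤s z≤n)) small

    remove-triangle : ∀ {x y z E M S} → Inv ((x , y) ∷ (x , z) ∷ (y , z) ∷ E) M S →
                      All (Avoids x) E → All (Avoids y) E → All (Avoids z) E → length E ≤ k →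
                      Decomposable (total ((x , y) ∷ (x , z) ∷ (y , z) ∷ E) M S)
    remove-triangle {x} {y} {z} {E} {M}
      I@(inv _ _ ((x∈ , y∈ , x≢y) ∷ (_ , z∈ , x≢z) ∷ (_ , _ , y≢z) ∷ _) _) avoid-x avoid-y avoid-z l
      with S , σ ← extract₃ x∈ y∈ z∈ x≢y x≢z y≢z = via (total-vertices {M = M} σ)
        (finish S (Inv-vertices σ I) (2 ≤? length (ends M ++ S)))
      where
      finish : ∀ S → Inv ((x , y) ∷ (x , z) ∷ (y , z) ∷ E) M (x ∷ y ∷ z ∷ S) →
               Dec (2 ≤ length (ends M ++ S)) →
               Decomposable (total ((x , y) ∷ (x , z) ∷ (y , z) ∷ E) M (x ∷ y ∷ z ∷ S))
      finish S (inv v (_ ∷ _ ∷ _ ∷ s) (_ ∷ _ ∷ _ ∷ w) _) (yes big) =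
        via (absorb ((x , y) ∷ (x , z) ∷ (y , z) ∷ []) E (apex (x ∷ y ∷ z ∷ []))
              (triangle (Unique-resp-⊆ (refl ∷ refl ∷ ⊆-++⁺ (minimum (ends M)) (refl ∷ refl ∷ refl ∷ minimum S)) v)))
          (IH l (inv
            (Unique-resp-⊆ (refl ∷ refl ∷ ⊆-++⁺ (⊆-refl {x = ends M}) (_ ∷ʳ _ ∷ʳ _ ∷ʳ ⊆-refl)) v)
            s (narrow (narrow (narrow w avoid-x) avoid-y) avoid-z) big))
      finish S (inv v _ (_ ∷ _ ∷ _ ∷ w) _) (no small) =
        -- At most one further vertex remains, so `E` is empty. With none, the graph is the complete
        -- graph on five vertices, whose ten edges contradict divisibility.
        terminal M S E v (narrow (narrow (narrow w avoid-x) avoid-y) avoid-z) small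
        where
        terminal : ∀ M S E → Unique (a ∷ b ∷ ends M ++ x ∷ y ∷ z ∷ S) → All (Within S) E →
                   ¬ 2 ≤ length (ends M ++ S) →
                   Decomposable (total ((x , y) ∷ (x , z) ∷ (y , z) ∷ E) M (x ∷ y ∷ z ∷ S))
        terminal (just _) S       E  v w small d = contradiction (s≤s (s≤s z≤n)) small
        terminal nothing []       [] v w small d = contradiction d (from-no (3 ∣? 10))
        terminal nothing []       (_ ∷ _) v ((() , _) ∷ _) small d
        terminal nothing (_ ∷ []) [] v w small d = triangle-and-isolated v
        terminal nothing (_ ∷ []) _  v ((here refl , here refl , p≢q) ∷ _) small d = contradiction refl p≢q
        terminal nothing (_ ∷ _ ∷ _) _ v w small d = contradiction (s≤s (s≤s z≤n)) small

    -- Putting the edge aside merely regroups `total`, but it shortens `E`; if another edge is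
    -- waiting already, both are spent by `two-edges`.
    isolated-edge : ∀ {x y E M S} → Inv ((x , y) ∷ E) M S → All (Avoids x) E → All (Avoids y) E →
                    length E ≤ k → Decomposable (total ((x , y) ∷ E) M S)
    isolated-edge {x} {y} {E} {nothing} I@(inv _ _ ((x∈ , y∈ , x≢y) ∷ _) _) avoid-x avoid-y l
      with S , σ ← extract₂ x∈ y∈ x≢y
      with inv v (_ ∷ s) (_ ∷ w) big ← Inv-vertices σ I =
        via (total-vertices {M = nothing} σ) (via
          (perm (↭-trans (↭-sym (↭-shift E _)) (++⁺ˡ E (shifts (kept (just (x , y))) (apex S)))) done)
          (IH {M = just (x , y)} l (inv v s (narrow (narrow w avoid-x) avoid-y) big)))
    isolated-edge {x} {y} {E} {just (z , w)} I@(inv _ _ ((x∈ , y∈ , x≢y) ∷ _) _) avoid-x avoid-y l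
      with S , σ ← extract₂ x∈ y∈ x≢y
      with inv v (_ ∷ s) (_ ∷ within) _ ← Inv-vertices σ I =
        via (total-vertices {M = just (z , w)} σ) (via
          (perm
            (↭-trans (↭-sym (↭-shift E _))
              (++⁺ˡ E (shifts (kept (just (x , y)) ++ apex S) (kept (just (z , w))))))
            (⟶-++ˡ E (⟶-++ʳ (apex S ++ (a , b) ∷ []) (two-edges (Unique.take⁺ 6 v)))))
          -- The surviving ends `z` and `x` return to the vertex list, and by themselves provide the
          -- two vertices for `big`.
          (IH {M = nothing} l (inv (Unique-resp-⊆ (refl ∷ refl ∷ refl ∷ _ ∷ʳ refl ∷ _ ∷ʳ ⊆-refl) v) s
            (All.map (λ (p∈ , q∈ , p≢q) → there (there p∈) , there (there q∈) , p≢q)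
              (narrow (narrow within avoid-x) avoid-y))
            (s≤s (s≤s z≤n)))))

    unique₄ : ∀ {p q r s : V} → p ≢ q → p ≢ r → p ≢ s → q ≢ r → q ≢ s → r ≢ s →
              Unique (p ∷ q ∷ r ∷ s ∷ [])
    unique₄ pq pr ps qr qs rs = (pq ∷ pr ∷ ps ∷ []) ∷ (qr ∷ qs ∷ []) ∷ (rs ∷ []) ∷ [] ∷ []

    via-edges : ∀ {E E′ M S} → E ↭ E′ →
                (length E′ ≤ suc k → Inv E′ M S → Decomposable (total E′ M S)) →
                length E ≤ suc k → Inv E M S → Decomposable (total E M S)
    via-edges {M = M} {S} σ dec l I = via (total-edges {M = M} {S} σ)
      (dec (subst (_≤ suc k) (xs↭ys⇒|xs|≡|ys| σ) l) (Inv-edges σ I))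

    -- The path is `z x y w`; for `w` equal to `z` the three edges would close up to a triangle.
    hook : ∀ {x y z w E M S} → w ≢ z → length ((x , y) ∷ (x , z) ∷ (y , w) ∷ E) ≤ suc k →
           Inv ((x , y) ∷ (x , z) ∷ (y , w) ∷ E) M S →
           Decomposable (total ((x , y) ∷ (x , z) ∷ (y , w) ∷ E) M S)
    hook w≢z l I@(inv _ ((xy≁xz ∷ xy≁yw ∷ _) ∷ _) ((_ , _ , x≢y) ∷ (_ , _ , x≢z) ∷ (_ , _ , y≢w) ∷ _) _) =
      remove-path (pull₃ _ 1F flip 0F same 0F same)
        (unique₄ (≢-sym x≢z) (λ { refl → xy≁xz same }) (≢-sym w≢z) x≢y (λ { refl → xy≁yw flip }) y≢w) l I

    -- The path is `u x y z`. No edge occurs twice, so the further neighbour `u` of `x` is neither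
    -- `y` nor `z`.
    kite : ∀ {x y z u E M S} → length ((x , y) ∷ (x , z) ∷ (y , z) ∷ (x , u) ∷ E) ≤ suc k →
           Inv ((x , y) ∷ (x , z) ∷ (y , z) ∷ (x , u) ∷ E) M S →
           Decomposable (total ((x , y) ∷ (x , z) ∷ (y , z) ∷ (x , u) ∷ E) M S)
    kite l I@(inv _ ((_ ∷ _ ∷ xy≁xu ∷ _) ∷ (_ ∷ xz≁xu ∷ _) ∷ _)
                    ((_ , _ , x≢y) ∷ (_ , _ , x≢z) ∷ (_ , _ , y≢z) ∷ (_ , _ , x≢u) ∷ _) _) =
      remove-path (pull₃ _ 3F flip 0F same 1F same)
        (unique₄ (≢-sym x≢u) (λ { refl → xy≁xu same }) (λ { refl → xz≁xu same }) x≢y x≢z y≢z) l I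

    -- A further edge at some corner gives a kite, after renaming the triangle so that this corner
    -- comes first. Otherwise the triangle is a whole component.
    at-triangle : ∀ {x y z E M S} → length ((x , y) ∷ (x , z) ∷ (y , z) ∷ E) ≤ suc k →
                  Inv ((x , y) ∷ (x , z) ∷ (y , z) ∷ E) M S →
                  Decomposable (total ((x , y) ∷ (x , z) ∷ (y , z) ∷ E) M S)
    at-triangle {x} {y} {z} {E} l I with split x E | split y E | split z E
    ... | inj₁ (u , _ , σ) | _ | _ =
          via-edges (↭-prep _ (↭-prep _ (↭-prep _ σ))) kite l I
    ... | inj₂ _ | inj₁ (u , _ , σ) | _ =
          via-edges (↭-trans (pull₃ _ 0F flip 1F same 0F same)
            (↭-prep _ (↭-prep _ (↭-prep _ σ)))) kite l I
    ... | inj₂ _ | inj₂ _ | inj₁ (u , _ , σ) =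
          via-edges (↭-trans (pull₃ _ 1F flip 1F flip 0F same)
            (↭-prep _ (↭-prep _ (↭-prep _ σ)))) kite l I
    ... | inj₂ avoid-x | inj₂ avoid-y | inj₂ avoid-z with s≤s l′ ← l =
          remove-triangle I avoid-x avoid-y avoid-z (≤-trans (m≤n+m _ 2) l′)

    -- A further edge at `y` or `z` yields a triangle or a path. Otherwise both are leaves, which is
    -- all that is asked: other edges at the centre `x` may remain, so stars shrink by two edges at
    -- a time.
    at-cherry : ∀ {x y z E M S} → length ((x , y) ∷ (x , z) ∷ E) ≤ suc k →
                Inv ((x , y) ∷ (x , z) ∷ E) M S → Decomposable (total ((x , y) ∷ (x , z) ∷ E) M S)
    at-cherry {x} {y} {z} {E} l I with split y E | split z E
    ... | inj₁ (w , _ , σ) | _ with w ≟ z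
    ...   | yes refl = via-edges (↭-prep _ (↭-prep _ σ)) at-triangle l I
    ...   | no w≢z   = via-edges (↭-prep _ (↭-prep _ σ)) (hook w≢z) l I
    at-cherry {x} {y} {z} {E} l I
        | inj₂ avoid-y | inj₁ (w , _ , σ) with (_ , w≢y) ∷ _ ← All-resp-↭ Avoids-resp σ avoid-y =
          via-edges (↭-trans (↭-swap _ _ ↭-refl) (↭-prep _ (↭-prep _ σ))) (hook w≢y) l I
    at-cherry {x} {y} {z} {E} l I
        | inj₂ avoid-y | inj₂ avoid-z with s≤s l′ ← l =
          remove-cherry I avoid-y avoid-z (≤-trans (m≤n+m _ 1) l′)

    at-edge : ∀ {x y E M S} → length ((x , y) ∷ E) ≤ suc k →
              Inv ((x , y) ∷ E) M S → Decomposable (total ((x , y) ∷ E) M S)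
    at-edge {x} {y} {E} l I with split x E | split y E
    ... | inj₁ (_ , _ , σ) | _                = via-edges (↭-prep _ σ) at-cherry l I
    ... | inj₂ _           | inj₁ (_ , _ , σ) = via-edges (prep flip σ) at-cherry l I
    ... | inj₂ avoid-x     | inj₂ avoid-y with s≤s l′ ← l = isolated-edge I avoid-x avoid-y l′

  -- Induction on a bound for the length of `E`: every reduction shortens `E`, whereas the vertex
  -- list need not get shorter.
  decomposable : ∀ k {E M S} → length E ≤ k → Inv E M S → Decomposable (total E M S)
  decomposable _       {[]} {M} {S}  _ (inv v _ _ big) = isolated-vertices M S v big
  decomposable (suc k) {_ ∷ _}  l I               = Step.at-edge k (decomposable k) l I

  -- The edges at the two new vertices

  Inside : UEdge V → Set
  Inside e = Avoids a e × Avoids b e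

  avoids⇒≁ : ∀ {x w : V} {f} → Avoids x f → ¬ (x , w) ∼ f
  avoids⇒≁ (p≢x , _) same = p≢x refl
  avoids⇒≁ (_ , q≢x) flip = q≢x refl

  -- Arranged so that `E ++ joinEdges S` is `total E nothing S` by definition.
  joinEdges : List V → List (UEdge V)
  joinEdges S = apex S ++ (a , b) ∷ []

  joinEdges-avoid : ∀ {x} S → x ≢ a → x ≢ b → All (x ≢_) S → All (Avoids x) (joinEdges S)
  joinEdges-avoid []      x≢a x≢b []           = (≢-sym x≢a , ≢-sym x≢b) ∷ []
  joinEdges-avoid (_ ∷ S) x≢a x≢b (x≢s ∷ x∉S) =
    (≢-sym x≢s , ≢-sym x≢a) ∷ (≢-sym x≢s , ≢-sym x≢b) ∷ joinEdges-avoid S x≢a x≢b x∉S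

  joinEdges-outside : ∀ S → All (λ (_ , q) → q ≡ a ⊎ q ≡ b) (joinEdges S)
  joinEdges-outside []      = inj₂ refl ∷ []
  joinEdges-outside (_ ∷ S) = inj₁ refl ∷ inj₂ refl ∷ joinEdges-outside S

  inside-≁ : ∀ {e S} → Inside e → All (λ f → ¬ e ∼ f) (joinEdges S)
  inside-≁ {S = S} (avoid-a , avoid-b) =
    All.map (λ { {_ , _} (inj₁ refl) e∼f → avoids⇒≁ avoid-a (∼-trans flip (∼-sym e∼f))
               ; {_ , _} (inj₂ refl) e∼f → avoids⇒≁ avoid-b (∼-trans flip (∼-sym e∼f)) })
      (joinEdges-outside S)

  joinEdges-simple : ∀ S → Unique (a ∷ b ∷ S) → Simple (joinEdges S)
  joinEdges-simple []      _ = [] ∷ []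
  joinEdges-simple (x ∷ S) u@((a≢b ∷ a≢x ∷ _) ∷ (b≢x ∷ _) ∷ x∉S ∷ _) =
    (avoid-first ∷ All.map avoids⇒≁ avoids)
      ∷ All.map avoids⇒≁ avoids
      ∷ joinEdges-simple S (Unique-resp-⊆ (refl ∷ refl ∷ x ∷ʳ ⊆-refl) u)
    where
    avoids = joinEdges-avoid S (≢-sym a≢x) (≢-sym b≢x) x∉S
    avoid-first : ¬ (x , a) ∼ (x , b)
    avoid-first e with ∼⁻ e
    ... | inj₁ (_ , a≡b) = a≢b a≡b
    ... | inj₂ (_ , a≡x) = a≢x a≡x

  joinEdges-loopless : ∀ S → Unique (a ∷ b ∷ S) → Loopless (joinEdges S)
  joinEdges-loopless []      ((a≢b ∷ _) ∷ _) = a≢b ∷ []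
  joinEdges-loopless (x ∷ S) u@((_ ∷ a≢x ∷ _) ∷ (b≢x ∷ _) ∷ _) =
    ≢-sym a≢x ∷ ≢-sym b≢x ∷ joinEdges-loopless S (Unique-resp-⊆ (refl ∷ refl ∷ x ∷ʳ ⊆-refl) u)

  ∈-joinEdges : ∀ {s S} → s ∈ S → (s , a) ∈ joinEdges S × (s , b) ∈ joinEdges S
  ∈-joinEdges (here refl) = here refl , there (here refl)
  ∈-joinEdges (there s∈)  = let p , q = ∈-joinEdges s∈ in there (there p) , there (there q)

  ab∈joinEdges : ∀ S → (a , b) ∈ joinEdges S
  ab∈joinEdges S = Any.++⁺ʳ (apex S) (here refl)

  joinEdges-covers : ∀ {S T} → (∀ {x y} → x ∈ S → y ∈ S → x ≢ y → (x , y) ∈∼ T) →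
    ∀ {x y} → x ∈ a ∷ b ∷ S → y ∈ a ∷ b ∷ S → x ≢ y → (x , y) ∈∼ T ++ joinEdges S
  joinEdges-covers {S} {T} cov = go
    where
    join : ∀ {e f} → f ∈ joinEdges S → e ∼ f → e ∈∼ T ++ joinEdges S
    join f∈ e∼f = Any.++⁺ʳ T (Any.map (λ { refl → e∼f }) f∈)
    go : ∀ {x y} → x ∈ a ∷ b ∷ S → y ∈ a ∷ b ∷ S → x ≢ y → (x , y) ∈∼ T ++ joinEdges S
    go (here refl)         (here refl)         x≢y = contradiction refl x≢y
    go (here refl)         (there (here refl)) x≢y = join (ab∈joinEdges S) same
    go (here refl)         (there (there y∈))  x≢y = join (proj₁ (∈-joinEdges y∈)) flip
    go (there (here refl)) (here refl)         x≢y = join (ab∈joinEdges S) flip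
    go (there (here refl)) (there (here refl)) x≢y = contradiction refl x≢y
    go (there (here refl)) (there (there y∈))  x≢y = join (proj₂ (∈-joinEdges y∈)) flip
    go (there (there x∈))  (here refl)         x≢y = join (proj₁ (∈-joinEdges x∈)) same
    go (there (there x∈))  (there (here refl)) x≢y = join (proj₂ (∈-joinEdges x∈)) same
    go (there (there x∈))  (there (there y∈))  x≢y = Any.++⁺ˡ (cov x∈ y∈ x≢y)

-- Designs as edge lists

module _ {V : Set} where

  open PathRemoval V

  -- A pigeonhole argument: each edge of `T` is struck out of `T′` in turn, and since `T` is simple,
  -- the later ones are still there. Applied in both directions, it shows that two simple lists with
  -- the same edges have the same length.
  Simple-length-≤ : ∀ {T T′} → Simple T → (∀ {e} → e ∈∼ T → e ∈∼ T′) → length T ≤ length T′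
  Simple-length-≤ {[]}    _        _   = z≤n
  Simple-length-≤ {e ∷ T} {T′} (e∉ ∷ s) sub =
    subst (_ ≤_) (sym (xs↭ys⇒|xs|≡|ys| σ)) (s≤s (Simple-length-≤ s sub′))
    where
    e∈ = sub (here same)
    σ = pull T′ (Any.index e∈) (∼-sym (Any.lookup-result e∈))
    sub′ : ∀ {f} → f ∈∼ T → f ∈∼ removeAt T′ (Any.index e∈)
    sub′ f∈ with Any-resp-↭ (λ p q → ∼-trans q p) σ (sub (there f∈))
    ... | there f∈T″ = f∈T″
    ... | here f∼e   =
          let e≁ , f∼ = All.lookupAny e∉ f∈ in contradiction (∼-trans (∼-sym f∼e) f∼) e≁

  pathEdges : (Fin 4 → V) → List (UEdge V)
  pathEdges t = (t 0F , t 1F) ∷ (t 1F , t 2F) ∷ (t 2F , t 3F) ∷ []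

  pathEdges-simple : ∀ {t : Fin 4 → V} → Injective _≡_ _≡_ t → Simple (pathEdges t)
  pathEdges-simple {t} inj =
    (apart (λ ()) (λ ()) ∷ apart (λ ()) (λ ()) ∷ []) ∷ (apart (λ ()) (λ ()) ∷ []) ∷ [] ∷ []
    where
    apart : ∀ {i j k l} → i ≢ k → i ≢ l → ¬ (t i , t j) ∼ (t k , t l)
    apart i≢k i≢l e with ∼⁻ e
    ... | inj₁ (p , _) = i≢k (inj p)
    ... | inj₂ (p , _) = i≢l (inj p)

  successor-edge : ∀ (t : Fin 4 → V) i j → suc (toℕ i) ≡ toℕ j → (t i , t j) ∈∼ pathEdges t
  successor-edge t 0F j p with refl ← Fin.toℕ-injective {i = 1F} {j} p = here same
  successor-edge t 1F j p with refl ← Fin.toℕ-injective {i = 2F} {j} p = there (here same)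
  successor-edge t 2F j p with refl ← Fin.toℕ-injective {i = 3F} {j} p = there (there (here same))
  successor-edge t 3F j p = contradiction (Fin.toℕ<n j) (<-irrefl (sym p))

  pathEdges⁺ : ∀ (t : Fin 4 → V) i j → Graph.Adj (P 4) i j → (t i , t j) ∈∼ pathEdges t
  pathEdges⁺ t i j (inj₁ p) = successor-edge t i j p
  pathEdges⁺ t i j (inj₂ p) = Any.map (∼-trans flip) (successor-edge t j i p)

  module _ {G : Graph V} where

    edge-resp : ∀ (H : Subgraph G) {x y u w} → (x , y) ∼ (u , w) → Edge H u w → Edge H x y
    edge-resp H same e = e
    edge-resp H flip e = edge-sym H e

    block-edges⁺ : ∀ {H : Subgraph G} (iso : H ≅ P 4) {x y} →
                   Edge H x y → (x , y) ∈∼ pathEdges (_≅_.to iso)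
    block-edges⁺ {H} iso e
      with i , refl ← _≅_.surjective iso (edge-end H e)
         | j , refl ← _≅_.surjective iso (edge-end H (edge-sym H e)) =
      pathEdges⁺ _ i j (_≅_.from-edge iso e)

    block-edges⁻ : ∀ {H : Subgraph G} (iso : H ≅ P 4) {x y} →
                   (x , y) ∈∼ pathEdges (_≅_.to iso) → Edge H x y
    block-edges⁻ {H} iso (here p)                 = edge-resp H p (_≅_.to-edge iso (inj₁ refl))
    block-edges⁻ {H} iso (there (here p))         = edge-resp H p (_≅_.to-edge iso (inj₁ refl))
    block-edges⁻ {H} iso (there (there (here p))) = edge-resp H p (_≅_.to-edge iso (inj₁ refl))

    flat : ∀ {B : List (Subgraph G)} → All (_≅ P 4) B → List (UEdge V)
    flat []           = []
    flat (iso ∷ isos) = pathEdges (_≅_.to iso) ++ flat isos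

    flat-++ : ∀ {B B′ : List (Subgraph G)} (isos : All (_≅ P 4) B) (isos′ : All (_≅ P 4) B′) →
              flat (All.++⁺ isos isos′) ≡ flat isos ++ flat isos′
    flat-++ []           isos′ = refl
    flat-++ (iso ∷ isos) isos′ = cong (pathEdges (_≅_.to iso) ++_) (flat-++ isos isos′)

    3∣length-flat : ∀ {B : List (Subgraph G)} (isos : All (_≅ P 4) B) → 3 ∣ length (flat isos)
    3∣length-flat []           = 3 ∣0
    3∣length-flat (iso ∷ isos) = ∣m∣n⇒∣m+n ∣-refl (3∣length-flat isos)

    flat⁺ : ∀ {B : List (Subgraph G)} (isos : All (_≅ P 4) B) {x y} →
            Any (λ H → Edge H x y) B → (x , y) ∈∼ flat isos
    flat⁺ (iso ∷ isos) (here e)  = Any.++⁺ˡ (block-edges⁺ iso e)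
    flat⁺ (iso ∷ isos) (there e) = Any.++⁺ʳ (pathEdges (_≅_.to iso)) (flat⁺ isos e)

    flat⁻ : ∀ {B : List (Subgraph G)} (isos : All (_≅ P 4) B) {x y} →
            (x , y) ∈∼ flat isos → Any (λ H → Edge H x y) B
    flat⁻ (iso ∷ isos) e with Any.++⁻ (pathEdges (_≅_.to iso)) e
    ... | inj₁ e∈ = here (block-edges⁻ iso e∈)
    ... | inj₂ e∈ = there (flat⁻ isos e∈)

    flat-simple : ∀ {B : List (Subgraph G)} (isos : All (_≅ P 4) B) →
                  AllPairs EdgeDisjoint B → Simple (flat isos)
    flat-simple []           []            = []
    flat-simple (iso ∷ isos) (disj ∷ disjs) =
      AllPairs.++⁺ (pathEdges-simple (_≅_.injective iso)) (flat-simple isos disjs)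
        (All.tabulate λ e∈ → All.tabulate λ f∈ e∼f →
          let d , e = All.lookupAny disj (flat⁻ isos (Any.map (λ { refl → e∼f }) f∈))
          in d (block-edges⁻ iso (Any.map (λ { refl → same }) e∈)) e)

    -- The way back from edge lists to designs: disjointness of the old and new blocks together is
    -- read off from one list of all their edges.
    flat-simple⁻ : ∀ {B : List (Subgraph G)} (isos : All (_≅ P 4) B) →
                   Simple (flat isos) → AllPairs EdgeDisjoint B
    flat-simple⁻ []           _                     = []
    flat-simple⁻ {H ∷ B} (iso ∷ isos) (e₁∉ ∷ e₂∉ ∷ e₃∉ ∷ s) =
      All.tabulate (λ {H′} H′∈ {x} {y} e e′ →
        disjoint (block-edges⁺ iso e) (flat⁺ isos (Any.map (λ { refl → e′ }) H′∈)))
      ∷ flat-simple⁻ isos s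
      where
      clash : ∀ {e f T} → e ∼ f → All (λ g → ¬ f ∼ g) T → e ∈∼ T → ⊥
      clash e∼f f∉ e∈ = let f≁ , e∼ = All.lookupAny f∉ e∈ in f≁ (∼-trans (∼-sym e∼f) e∼)
      disjoint : ∀ {e} → e ∈∼ pathEdges (_≅_.to iso) → ¬ e ∈∼ flat isos
      disjoint (here p)                 e∈ = clash p e₁∉ (there (there e∈))
      disjoint (there (here p))         e∈ = clash p e₂∉ (there e∈)
      disjoint (there (there (here p))) e∈ = clash p e₃∉ e∈

-- Paths as subgraphs of complete graphs

pathSubgraph : ∀ {n} (t : Fin 4 → Fin n) → Injective _≡_ _≡_ t → Subgraph (K n)
pathSubgraph t inj = record
  { Vert     = λ x → ∃ λ i → t i ≡ x
  ; Edge     = λ x y → ∃₂ λ i j → t i ≡ x × t j ≡ y × Graph.Adj (P 4) i j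
  ; edge-sym = λ (i , j , p , q , e) → j , i , q , p , Graph.adj-sym (P 4) {i} {j} e
  ; edge⊆    = λ { (i , j , p , q , e) refl → Graph.adj-irrefl (P 4) (inj (trans p (sym q))) e }
  ; edge-end = λ (i , _ , p , _) → i , p
  }

pathSubgraph-≅ : ∀ {n} (t : Fin 4 → Fin n) (inj : Injective _≡_ _≡_ t) → pathSubgraph t inj ≅ P 4
pathSubgraph-≅ t inj = record
  { to         = t
  ; injective  = inj
  ; to-vert    = λ i → i , refl
  ; surjective = id
  ; to-edge    = λ e → _ , _ , refl , refl , e
  ; from-edge  = λ (_ , _ , p , q , e) → subst₂ (Graph.Adj (P 4)) (inj p) (inj q) e
  }

extend-≅ : ∀ {v n} (v≤n : v ≤ n) {H : Subgraph (K v)} → H ≅ P 4 → extend v≤n H ≅ P 4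
extend-≅ v≤n {H} iso = record
  { to         = λ i → inject≤ (to i) v≤n
  ; injective  = injective ∘ ι-injective
  ; to-vert    = λ i → to i , refl , to-vert i
  ; surjective = λ { (_ , refl , x∈) → let i , p = surjective x∈ in i , cong (λ x → inject≤ x v≤n) p }
  ; to-edge    = λ e → _ , _ , refl , refl , to-edge e
  ; from-edge  = λ (_ , _ , p , q , e) → from-edge (subst₂ (Edge H) (ι-injective p) (ι-injective q) e)
  }
  where
  open _≅_ iso
  ι-injective : ∀ {x y} → inject≤ x v≤n ≡ inject≤ y v≤n → x ≡ y
  ι-injective = Fin.inject≤-injective v≤n v≤n _ _

-- Blocks from path removals, and the uncovered edges

module _ {n : ℕ} where

  open PathRemoval (Fin n)

  blocks-of : ∀ {T} → T ⟶ [] →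
              ∃ λ (B : List (Subgraph (K n))) → Σ (All (_≅ P 4) B) λ isos → T ↭ flat isos
  blocks-of done       = [] , [] , ↭-refl
  blocks-of (path u r) =
    let B , isos , σ = blocks-of r
    in _ ∷ B , pathSubgraph-≅ _ (lookup-injective u) ∷ isos , ↭-prep _ (↭-prep _ (↭-prep _ σ))
  blocks-of (perm τ r) = let B , isos , σ = blocks-of r in B , isos , ↭-trans τ σ

  missing? : ∀ (F : List (UEdge (Fin n))) e → Dec (toℕ (proj₁ e) < toℕ (proj₂ e) × ¬ e ∈∼ F)
  missing? F (x , y) = toℕ x <? toℕ y ×-dec ¬? (Any.any? (∼? Fin._≟_ (x , y)) F)

  -- Each edge is listed with its smaller end first, hence only once.
  missing : List (UEdge (Fin n)) → List (Fin n) → List (UEdge (Fin n))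
  missing F S = filter (missing? F) (cartesianProduct S S)

  ordered-simple : ∀ {E : List (UEdge (Fin n))} → All (λ (x , y) → toℕ x < toℕ y) E → Unique E → Simple E
  ordered-simple []       []       = []
  ordered-simple (x<y ∷ o) (e∉ ∷ u) =
    All.zipWith (λ { (_ , e≢e) same → e≢e refl ; (y<x , _) flip → <-irrefl refl (<-trans x<y y<x) }) (o , e∉)
      ∷ ordered-simple o u

  module _ (F : List (UEdge (Fin n))) (S : List (Fin n)) where

    missing⁻ : All (λ e → (proj₁ e ∈ S × proj₂ e ∈ S) × toℕ (proj₁ e) < toℕ (proj₂ e) × ¬ e ∈∼ F) (missing F S)
    missing⁻ = All.tabulate λ e∈ →
      let e∈S×S , miss = ∈-filter⁻ (missing? F) {xs = cartesianProduct S S} e∈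
      in ∈-cartesianProduct⁻ S S e∈S×S , miss

    missing-simple : Unique S → Simple (missing F S)
    missing-simple u = ordered-simple (All.map (λ (_ , x<y , _) → x<y) missing⁻)
      (Unique.filter⁺ (missing? F) (Unique.cartesianProduct⁺ u u))

    missing-covers : ∀ {x y} → x ∈ S → y ∈ S → x ≢ y → (x , y) ∈∼ F ++ missing F S
    missing-covers {x} {y} x∈ y∈ x≢y with Any.any? (∼? Fin._≟_ (x , y)) F
    ... | yes e∈F = Any.++⁺ˡ e∈F
    ... | no e∉F with <-cmp (toℕ x) (toℕ y)
    ...   | tri< x<y _ _ = Any.++⁺ʳ F (Any.map (λ { refl → same })
              (∈-filter⁺ (missing? F) (∈-cartesianProduct⁺ x∈ y∈) (x<y , e∉F)))
    ...   | tri≈ _ x≡y _ = contradiction (Fin.toℕ-injective x≡y) x≢y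
    ...   | tri> _ _ y<x = Any.++⁺ʳ F (Any.map (λ { refl → flip })
              (∈-filter⁺ (missing? F) (∈-cartesianProduct⁺ y∈ x∈)
                (y<x , λ e∈F → e∉F (Any.map (∼-trans flip) e∈F))))

  flat-loopless : ∀ {B : List (Subgraph (K n))} (isos : All (_≅ P 4) B) → Loopless (flat isos)
  flat-loopless isos = All.tabulate λ e∈ →
    let H , e = Any.satisfied (flat⁻ isos (Any.map (λ { refl → same }) e∈)) in edge⊆ H e

  -- Completing a partial design that avoids two vertices

  module _ {a b : Fin n} (a≢b : a ≢ b) {B : List (Subgraph (K n))} (partial : IsPartialDesign B)
    (avoid : ∀ {x y} → Any (λ H → Edge H x y) B → x ≢ a × x ≢ b) where

    open IsPartialDesign partial
    open Joins Fin._≟_ a b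
      using (Inv; inv; decomposable; Inside; inside-≁; joinEdges; joinEdges-simple;
             joinEdges-loopless; joinEdges-covers)

    -- As the blocks of `B` avoid `a` and `b`, all edges at these vertices are uncovered, and the
    -- uncovered edges form the join `T` of the graph `E` on `S` with the edge `ab`. The given
    -- design `B₀` enters through its number of edges and through the bound on `n`.
    complete-from : ∀ S → allFin n Perm.↭ a ∷ b ∷ S → Admissible n → ∃ λ B′ → IsDesign (B ++ B′)
    complete-from S σ (B₀ , design₀) = B₁ , record
      { isPartialDesign = record
        { blocks   = All.++⁺ blocks isos₁
        ; disjoint = flat-simple⁻ (All.++⁺ blocks isos₁) (subst Simple (sym (flat-++ blocks isos₁))
                       (Simple-resp-↭ (++⁺ˡ F σ₁) F++T-simple))
        }
      ; covers = λ x≢y → flat⁻ (All.++⁺ blocks isos₁) (subst (_ ∈∼_) (sym (flat-++ blocks isos₁))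
                   (Any-resp-↭ (λ p q → ∼-trans q p) (++⁺ˡ F σ₁) (F++T-covers x≢y)))
      }
      where
      open IsDesign design₀ renaming (isPartialDesign to partial₀; covers to covers₀)
      open IsPartialDesign partial₀ renaming (blocks to blocks₀; disjoint to disjoint₀)
      F = flat blocks
      verts : Unique (a ∷ b ∷ S)
      verts = Unique-resp-↭ σ (Unique.allFin⁺ n)
      ∈verts : ∀ x → x ∈ a ∷ b ∷ S
      ∈verts x = Perm.∈-resp-↭ σ (∈-allFin x)
      n≡2+S : n ≡ 2 + length S
      n≡2+S = trans (sym (length-tabulate {n = n} id)) (Perm.↭-length σ)
      -- Some block of `B₀` covers `ab`, and a block has four vertices. Without `a` and `b`, two
      -- vertices remain, as `big` requires.
      4≤n : 4 ≤ n
      4≤n = nonempty (covers₀ a≢b) blocks₀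
        where
        nonempty : ∀ {B : List (Subgraph (K n))} → Any (λ H → Edge H a b) B → All (_≅ P 4) B → 4 ≤ n
        nonempty _ (iso ∷ _) = Fin.injective⇒≤ (_≅_.injective iso)
      E = missing F S
      T = E ++ joinEdges S
      ∉ab : ∀ {x} → x ∈ S → x ≢ a × x ≢ b
      ∉ab x∈ with (_ ∷ a∉) ∷ b∉ ∷ _ ← verts = ≢-sym (All.lookup a∉ x∈) , ≢-sym (All.lookup b∉ x∈)
      F-inside : All Inside F
      F-inside = All.tabulate λ e∈ →
        let e = Any.map (λ { refl → same }) e∈
            x≢a , x≢b = avoid (flat⁻ blocks e)
            y≢a , y≢b = avoid (flat⁻ blocks (Any.map (∼-trans flip) e))
        in (x≢a , y≢a) , (x≢b , y≢b)
      E-inside : All Inside E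
      E-inside = All.map (λ ((x∈ , y∈) , _) →
        let x≢a , x≢b = ∉ab x∈
            y≢a , y≢b = ∉ab y∈
        in (x≢a , y≢a) , (x≢b , y≢b)) (missing⁻ F S)
      S-unique : Unique S
      S-unique = Unique.drop⁺ 2 verts
      E-loopless : Loopless E
      E-loopless = All.map (λ (_ , x<y , _) x≡y → <-irrefl (cong toℕ x≡y) x<y) (missing⁻ F S)
      F++T-simple : Simple (F ++ T)
      F++T-simple = AllPairs.++⁺ (flat-simple blocks disjoint)
        (AllPairs.++⁺ (missing-simple F S S-unique) (joinEdges-simple S verts)
          (All.map inside-≁ E-inside))
        (All.tabulate λ e∈ → All.++⁺
          (All.map (λ (_ , _ , f∉F) e∼f → f∉F (Any.map (λ { refl → ∼-sym e∼f }) e∈)) (missing⁻ F S))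
          (inside-≁ (All.lookup F-inside e∈)))
      F++T-covers : ∀ {x y} → x ≢ y → (x , y) ∈∼ F ++ T
      F++T-covers {x} {y} x≢y = subst (_ ∈∼_) (++-assoc F E _)
        (joinEdges-covers (missing-covers F S) (∈verts x) (∈verts y) x≢y)
      F++T-loopless : Loopless (F ++ T)
      F++T-loopless = All.++⁺ (flat-loopless blocks)
        (All.++⁺ E-loopless (joinEdges-loopless S verts))
      loopless-∈ : ∀ {L : List (UEdge (Fin n))} → Loopless L → ∀ {x y} → (x , y) ∈∼ L → x ≢ y
      loopless-∈ (p ∷ _)  (here same) = p
      loopless-∈ (p ∷ _)  (here flip) = ≢-sym p
      loopless-∈ (_ ∷ ps) (there e)   = loopless-∈ ps e
      -- Both lists contain every edge of K_n exactly once.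
      same-length : length (F ++ T) ≡ length (flat blocks₀)
      same-length = ≤-antisym
        (Simple-length-≤ F++T-simple (λ e∈ → flat⁺ blocks₀ (covers₀ (loopless-∈ F++T-loopless e∈))))
        (Simple-length-≤ (flat-simple blocks₀ disjoint₀) (λ e∈ → F++T-covers (loopless-∈ (flat-loopless blocks₀) e∈)))
      -- The edges of `B₀` and those of `B` both come in threes, hence so does the difference.
      3∣T : 3 ∣ length T
      3∣T = ∣m+n∣m⇒∣n (subst (3 ∣_) (trans (sym same-length) (length-++ F)) (3∣length-flat blocks₀))
        (3∣length-flat blocks)
      invariant : Inv E nothing S
      invariant with subst (4 ≤_) n≡2+S 4≤n
      ... | s≤s (s≤s 2≤S) = inv verts (missing-simple F S S-unique)
        (All.zipWith (λ (((x∈ , y∈) , _) , x≢y) → x∈ , y∈ , x≢y) (missing⁻ F S , E-loopless)) 2≤S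
      dec = blocks-of (decomposable (length E) ≤-refl invariant 3∣T)
      B₁ = proj₁ dec
      isos₁ = proj₁ (proj₂ dec)
      σ₁ = proj₂ (proj₂ dec)

    complete : Admissible n → ∃ λ B′ → IsDesign (B ++ B′)
    complete = let S , σ = extract₂ (∈-allFin a) (∈-allFin b) a≢b in complete-from S σ

-- Embedding into the larger complete graph

≈-refl : ∀ {V} {G : Graph V} {H : Subgraph G} → H ≈ H
≈-refl = (id , id) , id , id

theorem3p1 : ∀ (v : ℕ) (B : List (Subgraph (K v))) → IsPartialDesign B →
    ∀ (n : ℕ) → Admissible n → n ≥ v + 2 →
    ∃ λ (B′ : List (Subgraph (K n))) → IsDesign B′ × EmbeddedIn B B′
theorem3p1 v B partial n admissible v+2≤n =
  let B₁ , design = complete a≢b partialₑ avoid admissible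
  in map ext B ++ B₁ , design , v≤n ,
     All.tabulate λ {H} H∈ → Any.++⁺ˡ (Any.map⁺ (Any.map
       (λ { refl → ≈-refl {H = extend v≤n H} }) H∈))
  where
  2+v≤n : 2 + v ≤ n
  2+v≤n = subst (_≤ n) (+-comm v 2) v+2≤n
  1+v≤n : 1 + v ≤ n
  1+v≤n = ≤-trans (n≤1+n _) 2+v≤n
  v≤n : v ≤ n
  v≤n = ≤-trans (n≤1+n _) 1+v≤n
  ext = extend v≤n
  -- The vertices of K_v become the numbers below `v`, so `v` and `v + 1` are two new vertices; this
  -- is where `n ≥ v + 2` is used.
  a b : Fin n
  a = fromℕ< 1+v≤n
  b = fromℕ< 2+v≤n
  a≢b : a ≢ b
  a≢b a≡b = 1+n≢n (sym (Fin.fromℕ<-injective v (suc v) 1+v≤n 2+v≤n a≡b))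
  new : ∀ {w} (w<n : w < n) → v ≤ w → ∀ x → inject≤ x v≤n ≢ fromℕ< w<n
  new w<n v≤w x eq = <-irrefl
    (trans (sym (Fin.toℕ-inject≤ x v≤n)) (trans (cong toℕ eq) (Fin.toℕ-fromℕ< w<n)))
    (≤-trans (Fin.toℕ<n x) v≤w)
  open IsPartialDesign partial
  partialₑ : IsPartialDesign (map ext B)
  partialₑ = record
    { blocks   = All.map⁺ (All.map (extend-≅ v≤n) blocks)
    ; disjoint = AllPairs.map⁺ (AllPairs.map {R = EdgeDisjoint} {S = λ H H′ → EdgeDisjoint (ext H) (ext H′)}
                   (λ {H} {H′} → ext-disjoint {H} {H′}) disjoint)
    }
    where
    ι-injective : ∀ {x y} → inject≤ x v≤n ≡ inject≤ y v≤n → x ≡ y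
    ι-injective = Fin.inject≤-injective v≤n v≤n _ _
    ext-disjoint : ∀ {H H′ : Subgraph (K v)} → EdgeDisjoint H H′ → EdgeDisjoint (ext H) (ext H′)
    ext-disjoint {H′ = H′} disj (_ , _ , p , q , e) (_ , _ , p′ , q′ , e′) =
      disj e (subst₂ (Edge H′) (ι-injective (trans p′ (sym p))) (ι-injective (trans q′ (sym q))) e′)
  avoid : ∀ {x y} → Any (λ H → Edge H x y) (map ext B) → x ≢ a × x ≢ b
  avoid e with _ , x , _ , refl , _ ← Any.satisfied (Any.map⁻ {xs = B} e) =
    new 1+v≤n ≤-refl x , new 2+v≤n (n≤1+n v) x
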